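{- Let $G$ and $H$ be impartial games that are both $\mathcal{P}$-positions. Then the split sum $G \circ H$ is a $\mathcal{P}$-position.
   Context: All games are finite (short) impartial games under normal play (a player with no legal move loses). A game is identified with its set of options, written $\{g_1,\dots,g_k\}$; $\mathbf{E}$ denotes the game with no options. Two games are identical, $G\equiv H$, if they have the same set of options, recursively. A $\mathcal{P}$-position is a game whose options are all $\mathcal{N}$-positions (in particular $\mathbf{E}$ is a $\mathcal{P}$-position); an $\mathcal{N}$-position is a game having at least one option that is a $\mathcal{P}$-position. The split sum is defined recursively by: $G\circ H \equiv \mathbf{E}$ if $G\equiv \mathbf{E}$; $G\circ H\equiv G$ if $H\equiv\mathbf{E}$ (and $G\not\equiv\mathbf{E}$); otherwise $G\circ H \equiv \{G\circ h,\ g\circ H\}$ where $g$ ranges over the options of $G$ and $h$ over the options of $H$. -}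

module Defs where

open import Data.List.Base using (List; []; _∷_; _++_; map)
open import Data.List.Relation.Unary.All using (All; []; _∷_)
open import Data.List.Relation.Unary.Any using (Any)
open import Relation.Binary.PropositionalEquality using (_≡_; refl; cong; cong₂)

-- A short impartial game is a finitely branching well-founded tree.  The list
-- stands for the set of its members: order and repetitions are irrelevant, and
-- `_≅_` below is the resulting identity of games.
data Game : Set where
  node : List Game → Game

options : Game → List Game
options (node gs) = gs

E : Game
E = node []

infix 4 _≅_

data _≅_ : Game → Game → Set where
  identical : ∀ {G H} →
              All (λ g → Any (λ h → g ≅ h) (options H)) (options G) →
              All (λ h → Any (λ g → g ≅ h) (options G)) (options H) →
              G ≅ H

-- Being identical to E is the same as being literally `node []`, so the split
-- sum may decide `G ≅ E` by pattern matching.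
≅E⇒≡E : ∀ {G} → G ≅ E → G ≡ E
≅E⇒≡E {node []}      _                     = refl
≅E⇒≡E {node (_ ∷ _)} (identical (() ∷ _) _)

≡E⇒≅E : ∀ {G} → G ≡ E → G ≅ E
≡E⇒≅E refl = identical [] []

mutual
  data 𝒫-position (G : Game) : Set where
    𝒫-pos : All 𝒩-position (options G) → 𝒫-position G

  data 𝒩-position (G : Game) : Set where
    𝒩-pos : Any 𝒫-position (options G) → 𝒩-position G

infixr 9 _∘_

-- `G ∘ʳ hs` and `gs ∘ˡ H` are `map (G ∘_) hs` and `map (_∘ H) gs` (see
-- `options-∘`), unfolded so that the recursion is visibly structural.
mutual
  _∘_ : Game → Game → Game
  node []             ∘ H               = E
  G@(node (_ ∷ _))    ∘ node []         = G
  G@(node gs@(_ ∷ _)) ∘ H@(node hs@(_ ∷ _)) = node ((G ∘ʳ hs) ++ (gs ∘ˡ H))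

  _∘ʳ_ : Game → List Game → List Game
  G ∘ʳ []       = []
  G ∘ʳ (h ∷ hs) = (G ∘ h) ∷ (G ∘ʳ hs)

  _∘ˡ_ : List Game → Game → List Game
  []       ∘ˡ H = []
  (g ∷ gs) ∘ˡ H = (g ∘ H) ∷ (gs ∘ˡ H)

∘ʳ≡map : ∀ G hs → G ∘ʳ hs ≡ map (G ∘_) hs
∘ʳ≡map G []       = refl
∘ʳ≡map G (h ∷ hs) = cong ((G ∘ h) ∷_) (∘ʳ≡map G hs)

∘ˡ≡map : ∀ gs H → gs ∘ˡ H ≡ map (_∘ H) gs
∘ˡ≡map []       H = refl
∘ˡ≡map (g ∷ gs) H = cong ((g ∘ H) ∷_) (∘ˡ≡map gs H)

options-∘ : ∀ g gs h hs → let G = node (g ∷ gs); H = node (h ∷ hs) in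
            options (G ∘ H) ≡ map (G ∘_) (options H) ++ map (_∘ H) (options G)
options-∘ g gs h hs = cong₂ _++_ (∘ʳ≡map (node (g ∷ gs)) (h ∷ hs))
                                 (∘ˡ≡map (g ∷ gs) (node (h ∷ hs)))

{-# OPTIONS --safe #-}
-- Every option of G ∘ H moves one component from a 𝒫-position to an
-- 𝒩-position; the second player answers in the same component, restoring two
-- 𝒫-positions.  The answer is always available, because an 𝒩-position is not E
-- and hence the sum after the first move still has options in both components.
module Submission where

open import Data.List.Base using (List; []; _∷_)
open import Data.List.Relation.Unary.All using (All; []; _∷_)
open import Data.List.Relation.Unary.All.Properties using (++⁺)
open import Data.List.Relation.Unary.Any using (Any; here; there)
open import Data.List.Relation.Unary.Any.Properties using (++⁺ˡ; ++⁺ʳ)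
open import Defs

private
  variable
    g h : Game
    gs hs : List Game
    G H : Game

mutual
  𝒫∘𝒫 : 𝒫-position G → 𝒫-position H → 𝒫-position (G ∘ H)
  𝒫∘𝒫 {node []}      {_}            _  _  = 𝒫-pos []
  𝒫∘𝒫 {node (_ ∷ _)} {node []}      pG _  = pG
  𝒫∘𝒫 {node (_ ∷ _)} {node (_ ∷ _)} pG@(𝒫-pos ngs) pH@(𝒫-pos nhs) =
    𝒫-pos (++⁺ (𝒫∘ʳ-all-𝒩 pG nhs) (all-𝒩∘ˡ𝒫 ngs pH))

  𝒫∘ʳ-all-𝒩 : 𝒫-position (node (g ∷ gs)) → All 𝒩-position hs →
              All 𝒩-position (node (g ∷ gs) ∘ʳ hs)
  𝒫∘ʳ-all-𝒩 pG []         = []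
  𝒫∘ʳ-all-𝒩 pG (nh ∷ nhs) = 𝒫∘𝒩 pG nh ∷ 𝒫∘ʳ-all-𝒩 pG nhs

  all-𝒩∘ˡ𝒫 : All 𝒩-position gs → 𝒫-position (node (h ∷ hs)) →
             All 𝒩-position (gs ∘ˡ node (h ∷ hs))
  all-𝒩∘ˡ𝒫 []         pH = []
  all-𝒩∘ˡ𝒫 (ng ∷ ngs) pH = 𝒩∘𝒫 ng pH ∷ all-𝒩∘ˡ𝒫 ngs pH

  -- The left component must be nonempty: `E ∘ H` is `E`, a 𝒫-position, whatever `H` is.
  𝒫∘𝒩 : 𝒫-position (node (g ∷ gs)) → 𝒩-position H →
        𝒩-position (node (g ∷ gs) ∘ H)
  -- A winning move in `H` rules out `E`, so the sum unfolds; replies in `H` are the left half of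
  -- its options.
  𝒫∘𝒩 {H = node (_ ∷ _)} pG (𝒩-pos phs) = 𝒩-pos (++⁺ˡ (𝒫∘ʳ-any-𝒫 pG phs))

  𝒩∘𝒫 : 𝒩-position G → 𝒫-position (node (h ∷ hs)) →
        𝒩-position (G ∘ node (h ∷ hs))
  𝒩∘𝒫 {G = G@(node (_ ∷ _))} {h} {hs} (𝒩-pos pgs) pH =
    𝒩-pos (++⁺ʳ (G ∘ʳ (h ∷ hs)) (any-𝒫∘ˡ𝒫 pgs pH))

  𝒫∘ʳ-any-𝒫 : 𝒫-position G → Any 𝒫-position hs → Any 𝒫-position (G ∘ʳ hs)
  𝒫∘ʳ-any-𝒫 pG (here ph)   = here (𝒫∘𝒫 pG ph)
  𝒫∘ʳ-any-𝒫 pG (there phs) = there (𝒫∘ʳ-any-𝒫 pG phs)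

  any-𝒫∘ˡ𝒫 : Any 𝒫-position gs → 𝒫-position H → Any 𝒫-position (gs ∘ˡ H)
  any-𝒫∘ˡ𝒫 (here pg)   pH = here (𝒫∘𝒫 pg pH)
  any-𝒫∘ˡ𝒫 (there pgs) pH = there (any-𝒫∘ˡ𝒫 pgs pH)

theorem2p2 : (G H : Game) → 𝒫-position G → 𝒫-position H → 𝒫-position (G ∘ H)
theorem2p2 _ _ pG pH = 𝒫∘𝒫 pG pH
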